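{- Let $G$ be a bipartite permutation graph with a transitive vertex ordering $<$. Let $M=\{e_1,e_2,\ldots,e_t\}$ be a matching in $G$ where $l(e_1)<l(e_2)<\cdots<l(e_t)$. Then $M$ is uniquely restricted if and only if $\{e_i,e_{i+1}\}$ is a uniquely restricted matching in $G$ for each $i\in\{1,2,\ldots,t-1\}$.
   Context: Graphs are finite, simple, undirected. A permutation graph is a graph isomorphic to some $G_\pi$, where for a permutation $\pi$ of $\{1,\dots,n\}$, $G_\pi$ has vertex set $\{1,\dots,n\}$ and edges $ij$ with $(i-j)(\pi(i)-\pi(j))<0$; a bipartite permutation graph is a permutation graph that is bipartite. An ordering $<$ of $V(G)$ is a transitive vertex ordering if for all $u<v<w$: (a) $uv,vw\in E(G)$ implies $uw\in E(G)$, and (b) $uw\in E(G)$ implies $uv\in E(G)$ or $vw\in E(G)$. For an edge $e=uv$, $l(e)=\min_<\{u,v\}$ and $r(e)=\max_<\{u,v\}$. A matching is a set of pairwise vertex-disjoint edges; it is uniquely restricted if no other matching of $G$ matches exactly the same vertex set. -}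

module Defs where

open import Data.Bool.Base using (Bool)
open import Data.Fin.Base using (Fin; toℕ)
open import Data.Fin.Permutation using (Permutation′; _⟨$⟩ʳ_)
open import Data.Integer.Base as ℤ using (ℤ; +_; 0ℤ)
import Data.Integer.Properties as ℤ
open import Data.List.Base using (List)
open import Data.List.Relation.Unary.AllPairs using (AllPairs)
open import Data.List.Relation.Unary.Any using (Any)
import Data.List.Relation.Binary.Subset.Setoid as Subset
open import Data.Nat.Base using (ℕ)
open import Data.Product.Base using (Σ; ∃; ∃-syntax; _×_; _,_)
open import Data.Sum.Base using (_⊎_; inj₁; inj₂)
open import Function.Bundles using (_↔_; _⇔_; Inverse)
open import Function.Construct.Identity using (↔-id)
open import Level using (0ℓ)
open import Relation.Binary.Bundles using (Setoid)
open import Relation.Binary.Core using (Rel)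
open import Relation.Binary.Definitions
  using (Decidable; Symmetric; tri<; tri≈; tri>)
open import Relation.Binary.Structures using (IsStrictTotalOrder)
open import Relation.Binary.PropositionalEquality
open import Relation.Nullary using (¬_)

-- Decidability of adjacency is automatic classically.
record Graph : Set₁ where
  field
    V       : Set
    size    : ℕ
    finite  : V ↔ Fin size
    Adj     : Rel V 0ℓ
    adj?    : Decidable Adj
    sym-adj : Symmetric Adj
    irrefl  : ∀ {v} → ¬ Adj v v

record _≅_ (G H : Graph) : Set where
  private
    module G = Graph G
    module H = Graph H
  field
    bijection : G.V ↔ H.V
    adj⇔adj   : ∀ u v → G.Adj u v ⇔
                H.Adj (Inverse.to bijection u) (Inverse.to bijection v)

-- The vertices 1, …, n are represented by Fin n, so both labels and values
-- are shifted by one; the differences below are unaffected.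
module _ {n : ℕ} (π : Permutation′ n) where

  private
    _-ᶠ_ : Fin n → Fin n → ℤ
    i -ᶠ j = + toℕ i ℤ.- + toℕ j

    flip-ᶠ : ∀ i j → j -ᶠ i ≡ ℤ.- (i -ᶠ j)
    flip-ᶠ i j = sym (⁻¹-anti-homo-// (+ toℕ i) (+ toℕ j))
      where open import Algebra.Properties.AbelianGroup ℤ.+-0-abelianGroup
              using (⁻¹-anti-homo-//)

  inversionProduct : Fin n → Fin n → ℤ
  inversionProduct i j = (i -ᶠ j) ℤ.* ((π ⟨$⟩ʳ i) -ᶠ (π ⟨$⟩ʳ j))

  private
    neg*neg : ∀ x y → (ℤ.- x) ℤ.* (ℤ.- y) ≡ x ℤ.* y
    neg*neg x y = begin
      (ℤ.- x) ℤ.* (ℤ.- y)   ≡⟨ ℤ.neg-distribˡ-* x (ℤ.- y) ⟨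
      ℤ.- (x ℤ.* (ℤ.- y))   ≡⟨ cong ℤ.-_ (ℤ.neg-distribʳ-* x y) ⟨
      ℤ.- (ℤ.- (x ℤ.* y))   ≡⟨ ℤ.neg-involutive (x ℤ.* y) ⟩
      x ℤ.* y               ∎
      where open ≡-Reasoning

    product-sym : ∀ i j → inversionProduct i j ≡ inversionProduct j i
    product-sym i j = sym (trans
      (cong₂ ℤ._*_ (flip-ᶠ i j) (flip-ᶠ (π ⟨$⟩ʳ i) (π ⟨$⟩ʳ j)))
      (neg*neg (i -ᶠ j) ((π ⟨$⟩ʳ i) -ᶠ (π ⟨$⟩ʳ j))))

    product-diag : ∀ i → inversionProduct i i ≡ 0ℤ
    product-diag i = cong (ℤ._* ((π ⟨$⟩ʳ i) -ᶠ (π ⟨$⟩ʳ i)))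
                          (ℤ.+-inverseʳ (+ toℕ i))

  permutationGraph : Graph
  permutationGraph = record
    { V       = Fin n
    ; size    = n
    ; finite  = ↔-id (Fin n)
    ; Adj     = λ i j → inversionProduct i j ℤ.< 0ℤ
    ; adj?    = λ i j → inversionProduct i j ℤ.<? 0ℤ
    ; sym-adj = λ {i} {j} → subst (ℤ._< 0ℤ) (product-sym i j)
    ; irrefl  = λ {i} → ℤ.<-irrefl (product-diag i)
    }

IsPermutationGraph : Graph → Set
IsPermutationGraph G = ∃[ n ] Σ (Permutation′ n) λ π → G ≅ permutationGraph π

IsBipartite : Graph → Set
IsBipartite G = ∃ λ (side : V → Bool) → ∀ {u v} → Adj u v → side u ≢ side v
  where open Graph G

IsBipartitePermutationGraph : Graph → Set
IsBipartitePermutationGraph G = IsPermutationGraph G × IsBipartite G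

module _ (G : Graph) where
  open Graph G

  record IsTransitiveVertexOrdering (_<_ : Rel V 0ℓ) : Set where
    field
      isStrictTotalOrder : IsStrictTotalOrder _≡_ _<_
      transitive         : ∀ {u v w} → u < v → v < w →
                           Adj u v → Adj v w → Adj u w
      cotransitive       : ∀ {u v w} → u < v → v < w →
                           Adj u w → Adj u v ⊎ Adj v w

  -- Edges are unordered pairs: end₁ and end₂ carry no orientation, and edges
  -- are compared by _≈ₑ_ below.
  record Edge : Set where
    constructor edge
    field
      end₁ end₂ : V
      adjacent  : Adj end₁ end₂

module _ {G : Graph} where
  open Graph G
  open Edge

  _∈ₑ_ : V → Edge G → Set
  v ∈ₑ e = v ≡ end₁ e ⊎ v ≡ end₂ e

  _≈ₑ_ : Rel (Edge G) 0ℓ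
  e ≈ₑ f = (end₁ e ≡ end₁ f × end₂ e ≡ end₂ f)
         ⊎ (end₁ e ≡ end₂ f × end₂ e ≡ end₁ f)

  edgeSetoid : Setoid 0ℓ 0ℓ
  edgeSetoid = record
    { Carrier       = Edge G
    ; _≈_           = _≈ₑ_
    ; isEquivalence = record
      { refl  = inj₁ (refl , refl)
      ; sym   = λ where
          (inj₁ (p , q)) → inj₁ (sym p , sym q)
          (inj₂ (p , q)) → inj₂ (sym q , sym p)
      ; trans = λ where
          (inj₁ (p , q)) (inj₁ (r , s)) → inj₁ (trans p r , trans q s)
          (inj₁ (p , q)) (inj₂ (r , s)) → inj₂ (trans p r , trans q s)
          (inj₂ (p , q)) (inj₁ (r , s)) → inj₂ (trans p s , trans q r)
          (inj₂ (p , q)) (inj₂ (r , s)) → inj₁ (trans p s , trans q r)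
      }
    }

  open Subset edgeSetoid using (_⊆_)

  _≐_ : Rel (List (Edge G)) 0ℓ
  M ≐ N = M ⊆ N × N ⊆ M

  Disjoint : Rel (Edge G) 0ℓ
  Disjoint e f = ∀ v → v ∈ₑ e → ¬ (v ∈ₑ f)

  -- A set of edges is given by listing its elements. AllPairs also forbids
  -- repetitions in the listing, since no edge is disjoint from itself.
  IsMatching : List (Edge G) → Set
  IsMatching = AllPairs Disjoint

  Matches : List (Edge G) → V → Set
  Matches M v = Any (v ∈ₑ_) M

  IsUniquelyRestricted : List (Edge G) → Set
  IsUniquelyRestricted M =
    IsMatching M ×
    (∀ N → IsMatching N → (∀ v → Matches N v ⇔ Matches M v) → N ≐ M)

  leftEnd : {_<_ : Rel V 0ℓ} → IsTransitiveVertexOrdering G _<_ → Edge G → V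
  leftEnd ord e with IsStrictTotalOrder.compare
    (IsTransitiveVertexOrdering.isStrictTotalOrder ord) (end₁ e) (end₂ e)
  ... | tri< _ _ _ = end₁ e
  ... | tri≈ _ _ _ = end₁ e
  ... | tri> _ _ _ = end₂ e

{-# OPTIONS --safe #-}

-- In a bipartite graph the transitivity axiom excludes paths u < v < w, so
-- every vertex has all its neighbours on one side. Call edges e, f crossing
-- when l(e)r(f) and l(f)r(e) are edges; a uniquely restricted pair is a
-- non-crossing one. If l(c) < l(i) < l(b) and c, b cross, then c, i or i, b
-- cross, so when consecutive edges do not cross, no two edges of M do. Now let
-- N match the vertices of M and let e be the first edge of M not in N. Then N
-- joins l(e) to some r(f) and r(e) to some l(g) with f, g later than e in M,
-- and comparing l(f) with l(g) yields two crossing edges among e, f, g.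
-- Conversely, replacing a part of M by another matching of the same vertices
-- shows that every part of a uniquely restricted M is uniquely restricted.
module Submission where

open import Defs
open import Data.Bool.Base using (true; false)
open import Data.Empty using (⊥; ⊥-elim)
open import Data.List.Base using (List; []; _∷_; _++_)
open import Data.List.Membership.Propositional using (_∈_; find)
import Data.List.Membership.Setoid as Membership
open import Data.List.Relation.Unary.All as All using (All; []; _∷_)
open import Data.List.Relation.Unary.AllPairs using (AllPairs; []; _∷_)
open import Data.List.Relation.Unary.Any as Any using (Any; here; there)
open import Data.List.Relation.Unary.Linked as Linked using (Linked; []; [-]; _∷_)
open import Data.List.Relation.Unary.Linked.Properties using (Linked⇒AllPairs)
import Data.List.Relation.Binary.Subset.Setoid as Subset
open import Data.List.Relation.Binary.Permutation.Propositional
  using (_↭_; ↭-sym; ↭⇒↭ₛ)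
open import Data.List.Relation.Binary.Permutation.Propositional.Properties
  using (Any-resp-↭; ++-comm)
open import Data.List.Relation.Binary.Permutation.Setoid.Properties
  using (AllPairs-resp-↭)
open import Data.Product.Base using (∃; _×_; _,_; proj₁; proj₂)
open import Data.Sum.Base using (_⊎_; inj₁; inj₂)
open import Function.Base using (_∘_; case_of_)
open import Function.Bundles using (_⇔_; mk⇔; Equivalence)
open import Level using (0ℓ)
open import Relation.Binary.Bundles using (Setoid)
open import Relation.Binary.Core using (Rel)
open import Relation.Binary.Definitions using (Transitive; tri<; tri≈; tri>)
open import Relation.Binary.Structures using (IsStrictTotalOrder)
open import Relation.Binary.PropositionalEquality
open import Relation.Nullary using (¬_)

AllPairs-lookup : ∀ {A : Set} {R : Rel A 0ℓ} {xs x y} → AllPairs R xs →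
                  x ∈ xs → y ∈ xs → x ≡ y ⊎ (R x y ⊎ R y x)
AllPairs-lookup (_  ∷ _)  (here refl) (here refl) = inj₁ refl
AllPairs-lookup (px ∷ _)  (here refl) (there y∈)  = inj₂ (inj₁ (All.lookup px y∈))
AllPairs-lookup (px ∷ _)  (there x∈)  (here refl) = inj₂ (inj₂ (All.lookup px x∈))
AllPairs-lookup (_  ∷ ps) (there x∈)  (there y∈)  = AllPairs-lookup ps x∈ y∈

-- Matchings and unique restriction in an arbitrary graph.

module _ {G : Graph} where
  open Graph G
  open Edge
  open Subset (edgeSetoid {G}) using (_⊆_)
  open Membership (edgeSetoid {G}) using () renaming (_∈_ to _∈≈_)
  open Setoid (edgeSetoid {G}) using () renaming (sym to ≈-sym)

  private
    variable
      e f   : Edge G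
      u v   : V
      M M′ N : List (Edge G)

  Matches⇔ : (M N : List (Edge G)) → Set
  Matches⇔ M N = ∀ v → Matches M v ⇔ Matches N v

  ∈ₑ-resp-≈ : (e f : Edge G) → e ≈ₑ f → v ∈ₑ e → v ∈ₑ f
  ∈ₑ-resp-≈ e f (inj₁ (refl , refl)) v∈e         = v∈e
  ∈ₑ-resp-≈ e f (inj₂ (refl , refl)) (inj₁ refl) = inj₂ refl
  ∈ₑ-resp-≈ e f (inj₂ (refl , refl)) (inj₂ refl) = inj₁ refl

  other-end : v ∈ₑ e → ∃ λ w → w ∈ₑ e × Adj v w
  other-end {e = e} (inj₁ refl) = end₂ e , inj₂ refl , adjacent e
  other-end {e = e} (inj₂ refl) = end₁ e , inj₁ refl , sym-adj (adjacent e)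

  ends-determine : Adj u v → u ∈ₑ e → v ∈ₑ e → u ∈ₑ f → v ∈ₑ f → e ≈ₑ f
  ends-determine a (inj₁ refl) (inj₁ refl) _ _ = ⊥-elim (irrefl a)
  ends-determine a (inj₂ refl) (inj₂ refl) _ _ = ⊥-elim (irrefl a)
  ends-determine a _ _ (inj₁ refl) (inj₁ refl) = ⊥-elim (irrefl a)
  ends-determine a _ _ (inj₂ refl) (inj₂ refl) = ⊥-elim (irrefl a)
  ends-determine a (inj₁ p) (inj₂ q) (inj₁ r) (inj₂ s) = inj₁ (trans (sym p) r , trans (sym q) s)
  ends-determine a (inj₁ p) (inj₂ q) (inj₂ r) (inj₁ s) = inj₂ (trans (sym p) r , trans (sym q) s)
  ends-determine a (inj₂ p) (inj₁ q) (inj₁ r) (inj₂ s) = inj₂ (trans (sym q) s , trans (sym p) r)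
  ends-determine a (inj₂ p) (inj₁ q) (inj₂ r) (inj₁ s) = inj₁ (trans (sym q) s , trans (sym p) r)

  Disjoint-sym : Disjoint e f → Disjoint f e
  Disjoint-sym d v v∈f v∈e = d v v∈e v∈f

  matching-unique : IsMatching M → e ∈ M → f ∈ M → v ∈ₑ e → v ∈ₑ f → e ≡ f
  matching-unique m e∈ f∈ v∈e v∈f with AllPairs-lookup m e∈ f∈
  ... | inj₁ e≡f      = e≡f
  ... | inj₂ (inj₁ d) = ⊥-elim (d _ v∈e v∈f)
  ... | inj₂ (inj₂ d) = ⊥-elim (d _ v∈f v∈e)

  All-Disjoint⇒¬Matches : (e : Edge G) → All (Disjoint e) M → v ∈ₑ e → ¬ Matches M v
  All-Disjoint⇒¬Matches e d v∈e m = let f , f∈M , v∈f = find m in All.lookup d f∈M _ v∈e v∈f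

  All-Disjoint-resp : (e : Edge G) → Matches⇔ N M → All (Disjoint e) M → All (Disjoint e) N
  All-Disjoint-resp e N⇔M d = All.tabulate λ f∈N v v∈e v∈f →
    All-Disjoint⇒¬Matches e d v∈e
      (Equivalence.to (N⇔M v) (Any.map (λ { refl → v∈f }) f∈N))

  ∷-⊆-cancel : (e : Edge G) → All (Disjoint e) M → (e ∷ M) ⊆ (e ∷ N) → M ⊆ N
  ∷-⊆-cancel e d sub {x} x∈M with sub {x} (there x∈M)
  ... | there x∈N = x∈N
  ... | here x≈e  = ⊥-elim (All-Disjoint⇒¬Matches e d (∈ₑ-resp-≈ x e x≈e (inj₁ refl))
                      (Any.map (λ {y} x≈y → ∈ₑ-resp-≈ x y x≈y (inj₁ refl)) x∈M))

  -- A rival `N` of `M` covers the same vertices, hence avoids `e`. So `e ∷ N` is a rival of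
  -- `e ∷ M`, and `e` cancels from the resulting equality.
  uniquelyRestricted-tail : IsUniquelyRestricted (e ∷ M) → IsUniquelyRestricted M
  uniquelyRestricted-tail {e} {M} (e# ∷ m , unique) = m , λ N mN N⇔M →
    let e#N       = All-Disjoint-resp e N⇔M e#
        cons⇔ v   = mk⇔
          (λ { (here p) → here p ; (there p) → there (Equivalence.to (N⇔M v) p) })
          (λ { (here p) → here p ; (there p) → there (Equivalence.from (N⇔M v) p) })
        (sub , sup) = unique (e ∷ N) (e#N ∷ mN) cons⇔
    in (λ {x} → ∷-⊆-cancel e e#N (λ {y} → sub {y}) {x}) ,
       (λ {x} → ∷-⊆-cancel e e# (λ {y} → sup {y}) {x})

  uniquelyRestricted-resp-↭ : M ↭ M′ → IsUniquelyRestricted M → IsUniquelyRestricted M′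
  uniquelyRestricted-resp-↭ {M} {M′} p (m , unique) =
    AllPairs-resp-↭ (setoid (Edge G)) (λ {e} {f} → Disjoint-sym {e} {f}) (resp₂ Disjoint) (↭⇒↭ₛ p) m ,
    λ N mN N⇔M′ →
      let (sub , sup) = unique N mN λ v → mk⇔
            (Any-resp-↭ (↭-sym p) ∘ Equivalence.to (N⇔M′ v))
            (Equivalence.from (N⇔M′ v) ∘ Any-resp-↭ p)
      in (λ {x} x∈ → Any-resp-↭ p (sub {x} x∈)) ,
         (λ {x} x∈ → sup {x} (Any-resp-↭ (↭-sym p) x∈))

  uniquelyRestricted-++ʳ : ∀ M → IsUniquelyRestricted (M ++ N) → IsUniquelyRestricted N
  uniquelyRestricted-++ʳ []      ur = ur
  uniquelyRestricted-++ʳ (e ∷ M) ur = uniquelyRestricted-++ʳ M (uniquelyRestricted-tail ur)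

  -- Rotating the list turns the prefix into a suffix, which is reached by removing heads.
  uniquelyRestricted-++ˡ : ∀ M → IsUniquelyRestricted (M ++ N) → IsUniquelyRestricted M
  uniquelyRestricted-++ˡ {N} M =
    uniquelyRestricted-++ʳ N ∘ uniquelyRestricted-resp-↭ (++-comm M N)

  uniquelyRestricted-consecutive : ∀ M → IsUniquelyRestricted M →
    Linked (λ e f → IsUniquelyRestricted (e ∷ f ∷ [])) M
  uniquelyRestricted-consecutive []          ur = []
  uniquelyRestricted-consecutive (e ∷ [])    ur = [-]
  uniquelyRestricted-consecutive (e ∷ f ∷ M) ur =
    uniquelyRestricted-++ˡ (e ∷ f ∷ []) ur ∷
    uniquelyRestricted-consecutive (f ∷ M) (uniquelyRestricted-tail ur)

  -- Some edge of `M` meets the given edge of `N`. It lies in `N` too, and edges of a matching that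
  -- share a vertex coincide.
  ⊇⇒⊆ : IsMatching N → Matches⇔ N M → (∀ {f} → f ∈ M → f ∈≈ N) → N ⊆ M
  ⊇⇒⊆ {N} {M} mN N⇔M M⊆N {x} x∈N =
    let n , n∈N , x≈n = find x∈N
        f , f∈M , v∈f = find (Equivalence.to (N⇔M (end₁ x))
                          (Any.map (λ {y} x≈y → ∈ₑ-resp-≈ x y x≈y (inj₁ refl)) x∈N))
        k , k∈N , f≈k = find (M⊆N f∈M)
        n≡k = matching-unique mN n∈N k∈N (∈ₑ-resp-≈ x n x≈n (inj₁ refl)) (∈ₑ-resp-≈ f k f≈k v∈f)
        x≈f = Setoid.trans edgeSetoid {i = x} {j = n} {k = f} x≈n
                (subst (_≈ₑ f) (sym n≡k) (≈-sym {f} {k} f≈k))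
    in Any.map (λ { refl → x≈f }) f∈M

  -- The edge of `N` at `v` leads to a vertex `w`, which some edge `f` of `M` covers. Here `S`
  -- collects the edges after `e` that may still be missing from `N`.
  partner : IsMatching M → IsMatching N → Matches⇔ N M → ∀ {S} →
            (∀ {f} → f ∈ M → f ∈≈ N ⊎ f ∈ e ∷ S) → e ∈ M → v ∈ₑ e →
            e ∈≈ N ⊎ ∃ λ f → f ∈ S × ∃ λ w → w ∈ₑ f × Adj v w
  partner {e = e} {v = v} mM mN N⇔M covered e∈M v∈e
    with find (Equivalence.from (N⇔M v) (Any.map (λ { refl → v∈e }) e∈M))
  ... | n , n∈N , v∈n with other-end {e = n} v∈n
  ... | w , w∈n , a
    with find (Equivalence.to (N⇔M w) (Any.map (λ { refl → w∈n }) n∈N))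
  ... | f , f∈M , w∈f with covered f∈M
  ... | inj₂ (there f∈S) = inj₂ (f , f∈S , w , w∈f , a)
  ... | inj₂ (here refl) = inj₁ (Any.map (λ { refl → ends-determine {e = e} {f = n} a v∈e w∈f v∈n w∈n }) n∈N)
  ... | inj₁ f∈≈N with find f∈≈N
  ... | k , k∈N , f≈k
    -- The copy `k` of `f` in `N` meets `n` at `w`, so they are the same edge. Then `f` contains `v`
    -- and must be `e`.
    with refl ← matching-unique mN n∈N k∈N w∈n (∈ₑ-resp-≈ f k f≈k w∈f)
    with refl ← matching-unique mM e∈M f∈M v∈e (∈ₑ-resp-≈ k f (≈-sym {f} {k} f≈k) v∈n)
    = inj₁ f∈≈N

-- Adjacency and order between the ends of edges.

module _ {G : Graph} (bip : IsBipartite G) {_<_ : Rel (Graph.V G) 0ℓ}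
         (ord : IsTransitiveVertexOrdering G _<_) where
  open Graph G
  open Edge
  open IsTransitiveVertexOrdering ord
  open IsStrictTotalOrder isStrictTotalOrder using (compare) renaming (trans to <-trans)
  open Membership (edgeSetoid {G}) using () renaming (_∈_ to _∈≈_)

  -- In the impossible case of equal ends `leftEnd` takes `end₁`, so `end₂` is taken here: together
  -- the two always give both ends.
  rightEnd : Edge G → V
  rightEnd e with compare (end₁ e) (end₂ e)
  ... | tri< _ _ _ = end₂ e
  ... | tri≈ _ _ _ = end₂ e
  ... | tri> _ _ _ = end₁ e

  private
    l r : Edge G → V
    l = leftEnd ord
    r = rightEnd

  leftEnd<rightEnd : ∀ e → l e < r e
  leftEnd<rightEnd e with compare (end₁ e) (end₂ e)
  ... | tri< p _ _ = p
  ... | tri≈ _ p _ = ⊥-elim (irrefl (subst (Adj (end₁ e)) (sym p) (adjacent e)))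
  ... | tri> _ _ p = p

  ends-adjacent : ∀ e → Adj (l e) (r e)
  ends-adjacent e with compare (end₁ e) (end₂ e)
  ... | tri< _ _ _ = adjacent e
  ... | tri≈ _ _ _ = adjacent e
  ... | tri> _ _ _ = sym-adj (adjacent e)

  leftEnd∈ : ∀ e → l e ∈ₑ e
  leftEnd∈ e with compare (end₁ e) (end₂ e)
  ... | tri< _ _ _ = inj₁ refl
  ... | tri≈ _ _ _ = inj₁ refl
  ... | tri> _ _ _ = inj₂ refl

  rightEnd∈ : ∀ e → r e ∈ₑ e
  rightEnd∈ e with compare (end₁ e) (end₂ e)
  ... | tri< _ _ _ = inj₂ refl
  ... | tri≈ _ _ _ = inj₂ refl
  ... | tri> _ _ _ = inj₁ refl

  ∈ₑ⇒leftEnd⊎rightEnd : ∀ e {v} → v ∈ₑ e → v ≡ l e ⊎ v ≡ r e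
  ∈ₑ⇒leftEnd⊎rightEnd e v∈e with compare (end₁ e) (end₂ e) | v∈e
  ... | tri< _ _ _ | inj₁ p = inj₁ p
  ... | tri< _ _ _ | inj₂ p = inj₂ p
  ... | tri≈ _ _ _ | inj₁ p = inj₁ p
  ... | tri≈ _ _ _ | inj₂ p = inj₂ p
  ... | tri> _ _ _ | inj₁ p = inj₂ p
  ... | tri> _ _ _ | inj₂ p = inj₁ p

  triangle-free : ∀ {u v w} → Adj u v → Adj v w → Adj u w → ⊥
  triangle-free {u} {v} {w} uv vw uw
    with side u | side v | side w | side≢ uv | side≢ vw | side≢ uw
    where side = proj₁ bip
          side≢ = proj₂ bip
  ... | false | false | _     | p | _ | _ = p refl
  ... | true  | true  | _     | p | _ | _ = p refl
  ... | false | true  | false | _ | _ | p = p refl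
  ... | false | true  | true  | _ | p | _ = p refl
  ... | true  | false | true  | _ | _ | p = p refl
  ... | true  | false | false | _ | p | _ = p refl

  no-increasing-path : ∀ {u v w} → u < v → v < w → Adj u v → Adj v w → ⊥
  no-increasing-path u<v v<w uv vw = triangle-free uv vw (transitive u<v v<w uv vw)

  -- The later of the two left ends would be the middle of an increasing path that ends at its own
  -- right end.
  leftEnds-nonadjacent : ∀ e f → ¬ Adj (l e) (l f)
  leftEnds-nonadjacent e f a with compare (l e) (l f)
  ... | tri< p _ _ = no-increasing-path p (leftEnd<rightEnd f) a (ends-adjacent f)
  ... | tri≈ _ p _ = irrefl (subst (Adj (l e)) (sym p) a)
  ... | tri> _ _ p = no-increasing-path p (leftEnd<rightEnd e) (sym-adj a) (ends-adjacent e)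

  rightEnds-nonadjacent : ∀ e f → ¬ Adj (r e) (r f)
  rightEnds-nonadjacent e f a with compare (r e) (r f)
  ... | tri< p _ _ = no-increasing-path (leftEnd<rightEnd e) p (ends-adjacent e) a
  ... | tri≈ _ p _ = irrefl (subst (Adj (r e)) (sym p) a)
  ... | tri> _ _ p = no-increasing-path (leftEnd<rightEnd f) p (ends-adjacent f) (sym-adj a)

  adjacent⇒leftEnd<rightEnd : ∀ e f → Adj (l e) (r f) → l e < r f
  adjacent⇒leftEnd<rightEnd e f a with compare (l e) (r f)
  ... | tri< p _ _ = p
  ... | tri≈ _ p _ = ⊥-elim (irrefl (subst (Adj (l e)) (sym p) a))
  ... | tri> _ _ p =
    ⊥-elim (no-increasing-path (leftEnd<rightEnd f) p (ends-adjacent f) (sym-adj a))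

  -- Of the two edges offered by cotransitivity, the one from `u` to `l e` would extend to an
  -- increasing path through `r e`.
  leftEnd-between : ∀ {u w} e → u < l e → l e < w → Adj u w → Adj (l e) w
  leftEnd-between e p q a with cotransitive p q a
  ... | inj₁ b = ⊥-elim (no-increasing-path p (leftEnd<rightEnd e) b (ends-adjacent e))
  ... | inj₂ b = b

  rightEnd-between : ∀ {u w} e → u < r e → r e < w → Adj u w → Adj u (r e)
  rightEnd-between e p q a with cotransitive p q a
  ... | inj₁ b = b
  ... | inj₂ b = ⊥-elim (no-increasing-path (leftEnd<rightEnd e) q (ends-adjacent e) b)

  -- Crossing edges.

  Cross : Rel (Edge G) 0ℓ
  Cross e f = Adj (l e) (r f) × Adj (l f) (r e)

  -- The vertex `l f` lies under both `e` and the edge from `l e` to `r g`, so it is adjacent to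
  -- `r e` and `r g`. The order of `r f` and `r e` decides which pair gets its second edge.
  Cross-split : ∀ {e f g} → l e < l f → l f < l g → Cross e g → Cross e f ⊎ Cross f g
  Cross-split {e} {f} {g} e<f f<g (er , ge) = split
    where
    f<re : l f < r e
    f<re = <-trans f<g (adjacent⇒leftEnd<rightEnd g e ge)

    fe : Adj (l f) (r e)
    fe = leftEnd-between f e<f f<re (ends-adjacent e)

    fg : Adj (l f) (r g)
    fg = leftEnd-between f e<f (<-trans f<g (leftEnd<rightEnd g)) er

    split : Cross e f ⊎ Cross f g
    split with compare (r f) (r e)
    ... | tri< p _ _ = inj₁ (rightEnd-between f (<-trans e<f (leftEnd<rightEnd f)) p (ends-adjacent e) , fe)
    ... | tri≈ _ p _ = inj₁ (subst (Adj (l e)) (sym p) (ends-adjacent e) , fe)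
    ... | tri> _ _ p = inj₂ (fg , leftEnd-between g f<g
                         (<-trans (adjacent⇒leftEnd<rightEnd g e ge) p) (ends-adjacent f))

  infix 4 _◁_
  -- Combining the order of left ends with non-crossing gives a transitive relation, which passes
  -- from consecutive edges to all pairs.
  _◁_ : Rel (Edge G) 0ℓ
  e ◁ f = l e < l f × ¬ Cross e f

  ◁-trans : Transitive _◁_
  ◁-trans (e<f , ¬ef) (f<g , ¬fg) = <-trans e<f f<g , λ eg →
    case Cross-split e<f f<g eg of λ { (inj₁ ef) → ¬ef ef ; (inj₂ fg) → ¬fg fg }

  -- Exchanging right ends gives another matching of the same four vertices: its edge from `l e` to
  -- `r f` meets both `e` and `f`, so it equals neither.
  uniquelyRestricted⇒¬Cross : ∀ {e f} → IsUniquelyRestricted (e ∷ f ∷ []) → ¬ Cross e f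
  uniquelyRestricted⇒¬Cross {e} {f} (((e#f ∷ []) ∷ _) , unique) (ef , fe) =
    case proj₁ (unique N mN N⇔) {e′} (here (Setoid.refl edgeSetoid {x = e′})) of λ where
      (here e′≈e)         → e#f (r f) (∈ₑ-resp-≈ e′ e e′≈e (inj₂ refl)) (rightEnd∈ f)
      (there (here e′≈f)) → e#f (l e) (leftEnd∈ e) (∈ₑ-resp-≈ e′ f e′≈f (inj₁ refl))
    where
    e′ f′ : Edge G
    e′ = edge (l e) (r f) ef
    f′ = edge (l f) (r e) fe

    N : List (Edge G)
    N = e′ ∷ f′ ∷ []

    e′#f′ : Disjoint e′ f′
    e′#f′ v (inj₁ refl) (inj₁ q) = e#f v (leftEnd∈ e) (subst (_∈ₑ f) (sym q) (leftEnd∈ f))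
    e′#f′ v (inj₁ refl) (inj₂ q) = irrefl (subst (Adj (l e)) (sym q) (ends-adjacent e))
    e′#f′ v (inj₂ refl) (inj₁ q) = irrefl (subst (Adj (l f)) q (ends-adjacent f))
    e′#f′ v (inj₂ refl) (inj₂ q) = e#f v (subst (_∈ₑ e) (sym q) (rightEnd∈ e)) (rightEnd∈ f)

    mN : IsMatching N
    mN = (e′#f′ ∷ []) ∷ [] ∷ []

    to : ∀ v → Matches N v → Matches (e ∷ f ∷ []) v
    to v (here (inj₁ refl))         = here (leftEnd∈ e)
    to v (here (inj₂ refl))         = there (here (rightEnd∈ f))
    to v (there (here (inj₁ refl))) = there (here (leftEnd∈ f))
    to v (there (here (inj₂ refl))) = here (rightEnd∈ e)

    from : ∀ v → Matches (e ∷ f ∷ []) v → Matches N v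
    from v (here p) with ∈ₑ⇒leftEnd⊎rightEnd e p
    ... | inj₁ q = here (inj₁ q)
    ... | inj₂ q = there (here (inj₂ q))
    from v (there (here p)) with ∈ₑ⇒leftEnd⊎rightEnd f p
    ... | inj₁ q = there (here (inj₁ q))
    ... | inj₂ q = here (inj₂ q)

    N⇔ : Matches⇔ N (e ∷ f ∷ [])
    N⇔ v = mk⇔ (to v) (from v)

  -- If `l f` is at most `l g`, then `e` crosses `f`. Otherwise `e` crosses `g` when `r g` is at
  -- most `r f`, and `g` crosses `f` when `r f` comes first.
  no-rematching : ∀ {e f g S} → AllPairs _◁_ (e ∷ S) → f ∈ S → g ∈ S →
                  Adj (l e) (r f) → Adj (l g) (r e) → ⊥
  no-rematching {e} {f} {g} (e◁ ∷ S◁) f∈S g∈S ef ge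
    with All.lookup e◁ f∈S | All.lookup e◁ g∈S | AllPairs-lookup S◁ f∈S g∈S
  ... | _ , ¬ef | _ | inj₁ refl = ¬ef (ef , ge)
  ... | e<f , ¬ef | _ | inj₂ (inj₁ (f<g , _)) =
    ¬ef (ef , leftEnd-between f e<f
                (<-trans f<g (adjacent⇒leftEnd<rightEnd g e ge)) (ends-adjacent e))
  ... | _ | e<g , ¬eg | inj₂ (inj₂ (g<f , ¬gf)) with compare (r g) (r f)
  ...   | tri< p _ _ =
    ¬eg (rightEnd-between g (<-trans e<g (leftEnd<rightEnd g)) p ef , ge)
  ...   | tri≈ _ p _ = ¬eg (subst (Adj (l e)) (sym p) ef , ge)
  ...   | tri> _ _ p =
    ¬gf ( leftEnd-between g e<g (<-trans g<f (leftEnd<rightEnd f)) ef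
        , leftEnd-between f g<f (<-trans (leftEnd<rightEnd f) p) (ends-adjacent g))

  -- Uniqueness of a matching without crossings.

  module _ {M N : List (Edge G)} (mM : IsMatching M) (mN : IsMatching N)
           (N⇔M : Matches⇔ N M) where

    first∈ : ∀ {e S} → AllPairs _◁_ (e ∷ S) → e ∈ M →
             (∀ {f} → f ∈ M → f ∈≈ N ⊎ f ∈ e ∷ S) → e ∈≈ N
    first∈ {e} ◁s e∈M covered
      with partner {v = l e} mM mN N⇔M covered e∈M (leftEnd∈ e)
         | partner {v = r e} mM mN N⇔M covered e∈M (rightEnd∈ e)
    ... | inj₁ e∈N | _ = e∈N
    ... | _ | inj₁ e∈N = e∈N
    ... | inj₂ (f , f∈S , w , w∈f , lew) | inj₂ (g , g∈S , x , x∈g , rex)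
      with ∈ₑ⇒leftEnd⊎rightEnd f w∈f | ∈ₑ⇒leftEnd⊎rightEnd g x∈g
    ...   | inj₁ refl | _         = ⊥-elim (leftEnds-nonadjacent e f lew)
    ...   | inj₂ _    | inj₂ refl = ⊥-elim (rightEnds-nonadjacent e g rex)
    ...   | inj₂ refl | inj₁ refl = ⊥-elim (no-rematching ◁s f∈S g∈S lew (sym-adj rex))

    -- Induction along the list with `M` fixed: every edge of `M` is in `N` or in the remaining
    -- suffix `S`. At the start `S` is `M`, at the end it is empty.
    suffix∈ : ∀ {S} → AllPairs _◁_ S → (∀ {f} → f ∈ S → f ∈ M) →
              (∀ {f} → f ∈ M → f ∈≈ N ⊎ f ∈ S) → ∀ {f} → f ∈ M → f ∈≈ N
    suffix∈ {[]} _ _ covered f∈M with covered f∈M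
    ... | inj₁ f∈N = f∈N
    suffix∈ {e ∷ S} ◁s@(_ ∷ S◁) S⊆M covered = suffix∈ S◁ (S⊆M ∘ there) covered′
      where
      covered′ : ∀ {f} → f ∈ M → f ∈≈ N ⊎ f ∈ S
      covered′ f∈M with covered f∈M
      ... | inj₁ f∈N         = inj₁ f∈N
      ... | inj₂ (there f∈S) = inj₂ f∈S
      ... | inj₂ (here refl) = inj₁ (first∈ ◁s f∈M covered)

  ◁-uniquelyRestricted : ∀ {M} → IsMatching M → AllPairs _◁_ M → IsUniquelyRestricted M
  ◁-uniquelyRestricted {M} mM ◁s = mM , λ N mN N⇔M →
    let M⊆N : ∀ {f} → f ∈ M → f ∈≈ N
        M⊆N = suffix∈ mM mN N⇔M ◁s (λ f∈ → f∈) inj₂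
    -- Since `N` covers only vertices of `M`, containing `M` leaves it no further edge.
    in (λ {x} → ⊇⇒⊆ mN N⇔M M⊆N {x})
     , λ {x} x∈M → let f , f∈M , x≈f = find x∈M in
         Any.map (λ {n} f≈n → Setoid.trans edgeSetoid {i = x} {j = f} {k = n} x≈f f≈n) (M⊆N f∈M)

theorem6 : (G : Graph) → IsBipartitePermutationGraph G →
    (_<_ : Rel (Graph.V G) 0ℓ) (ord : IsTransitiveVertexOrdering G _<_) →
    (M : List (Edge G)) → IsMatching M →
    Linked (λ e f → leftEnd ord e < leftEnd ord f) M →
    IsUniquelyRestricted M ⇔ Linked (λ e f → IsUniquelyRestricted (e ∷ f ∷ [])) M
theorem6 G (_ , bip) _<_ ord M mM sorted = mk⇔
  (uniquelyRestricted-consecutive M)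
  (λ consecutive → ◁-uniquelyRestricted bip ord mM
    (Linked⇒AllPairs (◁-trans bip ord)
      (Linked.zipWith (λ (p , ur) → p , uniquelyRestricted⇒¬Cross bip ord ur)
        (sorted , consecutive))))
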